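{- Let $n$ be odd and $k=2$. For every $u\in\mathbb{F}_{2^n}^*$ with $v_u=1$, the unique nonzero element $w_u$ of $V_u$ satisfies $T(u,w_u)=1$; moreover, no $u\in\mathbb{F}_{2^n}^*$ with $v_u=3$ has $T(u,\cdot)\equiv0$ on $V_u$. Consequently: (i) $G_1(u)=0$ for every $u\in\mathbb{F}_{2^n}$; (ii) $g(x)=x(x+1)^5=\operatorname{MCM}(x)$ is exactly $2$-to-$1$ on $\mathbb{F}_{2^n}$, each (nonempty) fiber containing one element of $H_0$ and one of $H_1$; in particular $\operatorname{MCM}(H_0)=\operatorname{MCM}(H_1)=\Delta$; (iii) $2S(u)=H(u)=G_0(u)=\sum_{s\in\mathbb{F}_{2^n}}\chi\bigl(u\,g(s)\bigr)$ for all $u\neq0$.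
   Context: $\mathbb{F}_{2^n}$ is the field with $2^n$ elements ($n$ odd), $\operatorname{Tr}(x)=\sum_{i=0}^{n-1}x^{2^i}$ is the absolute trace, $\chi(x)=(-1)^{\operatorname{Tr}(x)}$, and $H_i=\{x:\operatorname{Tr}(x)=i\}$ for $i\in\{0,1\}$. For $k=2$: $F(x)=x^{13}$, $\delta(b)=F(b)+F(b+1)+1$, $\Delta=\{\delta(b): b\in\mathbb{F}_{2^n}\}$, $S(a)=\sum_{t\in\Delta}\chi(at)$, $H(u)=\sum_{b\in\mathbb{F}_{2^n}}\chi(u\,\delta(b))$, and the Müller–Cohen–Matthews polynomial is $\operatorname{MCM}(x)=(x+x^2)^5/x^4=x(x+1)^5=:g(x)$. For $\varepsilon\in\{0,1\}$, $G_\varepsilon(u)=\sum_{s\in\mathbb{F}_{2^n}}\chi(u\,g(s)+\varepsilon s)$. For $u\neq0$, with $\sqrt u$ the unique square root of $u$, let $Q_u(s)=\operatorname{Tr}(us^5+\sqrt u\,s^3)$, let $V_u=\{w: Q_u(s+w)+Q_u(s)+Q_u(w)=0\ \forall s\in\mathbb{F}_{2^n}\}$ be its radical (an $\mathbb{F}_2$-subspace), $v_u=\dim_{\mathbb{F}_2}V_u$, and $T(u,w)=\operatorname{Tr}(w+u\,g(w))$ for $w\in V_u$. -}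

module Defs where

open import Algebra.Bundles using (CommutativeRing)
open import Data.Bool.Base using (if_then_else_)
open import Data.Fin.Base using (Fin; toℕ; punchOut)
open import Data.Fin.Permutation using (Permutation; permutation)
open import Data.Fin.Properties using (any?; punchOut-injective; injective⇒≤) renaming (_≟_ to _≟F_)
open import Data.Integer.Base using (ℤ; 0ℤ; -1ℤ)
open import Data.Nat.Base using (ℕ; zero; suc) renaming (_^_ to _^ℕ_)
open import Data.Parity.Base using (Parity; 0ℙ; 1ℙ)
open import Data.Product using (∃; ∃₂; ∃!; _×_; _,_; proj₁; proj₂)
open import Data.Sum.Base using (_⊎_)
open import Function.Base using (_∘_)
open import Function.Bundles using (Inverse; _⇔_)
open import Function.Properties.Inverse using (Inverse⇒Injection)
import Function.Construct.Symmetry as Symmetry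
open import Level using (Level; _⊔_) renaming (suc to lsuc)
open import Relation.Binary.PropositionalEquality as ≡ using (_≡_; _≢_)
open import Relation.Nullary using (¬_; Dec; does; yes; no; contradiction)
open import Relation.Nullary.Decidable using (via-injection; map′)
open import Relation.Unary using (Pred; Decidable)

import Algebra.Properties.CommutativeMonoid.Sum as CommutativeMonoidSum
import Algebra.Properties.Group as GroupProperties
import Algebra.Properties.Semiring.Exp as SemiringExp
import Algebra.Properties.Semiring.Mult as SemiringMult
import Data.Integer.Base as ℤ
import Data.Integer.Properties as ℤₚ
import Data.Nat.Properties as ℕₚ
import Relation.Binary.Reasoning.Setoid as SetoidReasoning

-- A field with exactly q elements (counted up to _≈_).
record FiniteField (q : ℕ) (c ℓ : Level) : Set (lsuc (c ⊔ ℓ)) where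
  field
    commutativeRing : CommutativeRing c ℓ

  open CommutativeRing commutativeRing public

  field
    0≉1         : 0# ≉ 1#
    inverse     : ∀ x → x ≉ 0# → ∃ λ y → x * y ≈ 1#
    enumeration : Inverse (≡.setoid (Fin q)) setoid

  open Inverse enumeration public
    using () renaming (to to element; from to index)

  _≟_ : (x y : Carrier) → Dec (x ≈ y)
  _≟_ = via-injection (Inverse⇒Injection (Symmetry.inverse enumeration)) _≟F_

  any-element? : ∀ {p} {P : Pred Carrier p} → (∀ {x y} → x ≈ y → P x → P y) →
                 Decidable P → Dec (∃ P)
  any-element? resp P? =
    map′ (λ (i , p) → element i , p)
         (λ (x , p) → index x , resp (sym (Inverse.strictlyInverseˡ enumeration x)) p)
         (any? (P? ∘ element))

  -- Total inverse, with the convention 0⁻¹ = 0.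
  infix 8 _⁻¹
  _⁻¹ : Carrier → Carrier
  x ⁻¹ with x ≟ 0#
  ... | yes _   = 0#
  ... | no  x≉0 = proj₁ (inverse x x≉0)

  x*y≈0⇒y≈0 : ∀ {x y} → x ≉ 0# → x * y ≈ 0# → y ≈ 0#
  x*y≈0⇒y≈0 {x} {y} x≉0 xy≈0 with inverse x x≉0
  ... | z , xz≈1 = begin
    y           ≈⟨ *-identityˡ y ⟨
    1# * y      ≈⟨ *-congʳ (trans (*-comm z x) xz≈1) ⟨
    z * x * y   ≈⟨ *-assoc z x y ⟩
    z * (x * y) ≈⟨ *-congˡ xy≈0 ⟩
    z * 0#      ≈⟨ zeroʳ z ⟩
    0#          ∎
    where open SetoidReasoning setoid

injective⇒hits : ∀ {q} (f : Fin q → Fin q) → (∀ {i j} → f i ≡ f j → i ≡ j) →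
                 ∀ k → ¬ (∀ i → k ≢ f i)
injective⇒hits {suc q} f inj k misses =
  ℕₚ.1+n≰n (injective⇒≤ {f = λ i → punchOut (misses i)}
    (λ {i} {j} eq → inj (punchOut-injective (misses i) (misses j) eq)))

module BinaryField {n : ℕ} {c ℓ : Level} (𝔽 : FiniteField (2 ^ℕ n) c ℓ) where

  open FiniteField 𝔽 public
  open SemiringExp semiring public using (_^_)

  private
    module ∑𝔽 = CommutativeMonoidSum +-commutativeMonoid
    module ∑ℤ = CommutativeMonoidSum ℤₚ.+-0-commutativeMonoid
    module Mult = SemiringMult semiring
    module Gp = GroupProperties +-group

    translate : Permutation (2 ^ℕ n) (2 ^ℕ n)
    translate = permutation
      (λ i → index (element i + 1#)) (λ i → index (element i - 1#))
      (λ i → inv i (trans (+-assoc _ _ _) (trans (+-congˡ (-‿inverseˡ 1#)) (+-identityʳ _))))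
      (λ i → inv i (trans (+-assoc _ _ _) (trans (+-congˡ (-‿inverseʳ 1#)) (+-identityʳ _))))
      where
      module E = Inverse enumeration
      inv : ∀ {y z} i → element i + y + z ≈ element i →
            index (element (index (element i + y)) + z) ≡ i
      inv i eq = ≡.trans
        (E.from-cong (trans (+-congʳ (E.strictlyInverseˡ _)) eq)) (E.strictlyInverseʳ i)

    2ⁿ×1≈0 : (2 ^ℕ n) Mult.× 1# ≈ 0#
    2ⁿ×1≈0 = Gp.∙-cancelˡ Σx _ _ (begin
      Σx + (2 ^ℕ n) Mult.× 1#                    ≈⟨ +-congˡ (∑𝔽.sum-replicate (2 ^ℕ n)) ⟨
      Σx + ∑𝔽.sum {2 ^ℕ n} (λ _ → 1#)            ≈⟨ ∑𝔽.∑-distrib-+ element (λ _ → 1#) ⟨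
      ∑𝔽.sum (λ i → element i + 1#)              ≈⟨ ∑𝔽.sum-cong-≋ (λ i → E.strictlyInverseˡ (element i + 1#)) ⟨
      ∑𝔽.sum (λ i → element (index (element i + 1#))) ≈⟨ ∑𝔽.sum-permute element translate ⟨
      Σx                                         ≈⟨ +-identityʳ Σx ⟨
      Σx + 0#                                    ∎)
      where
      open SetoidReasoning setoid
      module E = Inverse enumeration
      Σx = ∑𝔽.sum element

    2ᵐ×1≈0⇒1+1≈0 : ∀ m → (2 ^ℕ m) Mult.× 1# ≈ 0# → 1# + 1# ≈ 0#
    2ᵐ×1≈0⇒1+1≈0 zero    eq = contradiction (sym (trans (sym (+-identityʳ 1#)) eq)) 0≉1
    2ᵐ×1≈0⇒1+1≈0 (suc m) eq with (1# + 1#) ≟ 0#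
    ... | yes p = p
    ... | no ¬p = 2ᵐ×1≈0⇒1+1≈0 m (x*y≈0⇒y≈0 ¬p (begin
      (1# + 1#) * (2 ^ℕ m) Mult.× 1#       ≈⟨ *-congʳ (+-congˡ (+-identityʳ 1#)) ⟨
      2 Mult.× 1# * (2 ^ℕ m) Mult.× 1#     ≈⟨ Mult.×1-homo-* 2 (2 ^ℕ m) ⟨
      (2 ^ℕ suc m) Mult.× 1#               ≈⟨ eq ⟩
      0#                                   ∎))
      where open SetoidReasoning setoid

  characteristic-2 : ∀ x → x + x ≈ 0#
  characteristic-2 x = begin
    x + x             ≈⟨ +-cong (*-identityˡ x) (*-identityˡ x) ⟨
    1# * x + 1# * x   ≈⟨ distribʳ x 1# 1# ⟨
    (1# + 1#) * x     ≈⟨ *-congʳ (2ᵐ×1≈0⇒1+1≈0 n 2ⁿ×1≈0) ⟩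
    0# * x            ≈⟨ zeroˡ x ⟩
    0#                ∎
    where open SetoidReasoning setoid

  square-injective : ∀ {x y} → x * x ≈ y * y → x ≈ y
  square-injective {x} {y} eq = x+y≈0⇒x≈y (square≈0 (begin
    (x + y) * (x + y)                 ≈⟨ distribʳ _ _ _ ⟩
    x * (x + y) + y * (x + y)         ≈⟨ +-cong (distribˡ _ _ _) (distribˡ _ _ _) ⟩
    (x * x + x * y) + (y * x + y * y) ≈⟨ +-assoc _ _ _ ⟩
    x * x + (x * y + (y * x + y * y)) ≈⟨ +-congˡ (+-assoc _ _ _) ⟨
    x * x + (x * y + y * x + y * y)   ≈⟨ +-cong eq (+-congʳ (trans (+-congˡ (*-comm y x)) (characteristic-2 _))) ⟩
    y * y + (0# + y * y)              ≈⟨ +-congˡ (+-identityˡ _) ⟩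
    y * y + y * y                     ≈⟨ characteristic-2 _ ⟩
    0#                                ∎))
    where
    open SetoidReasoning setoid
    square≈0 : ∀ {z} → z * z ≈ 0# → z ≈ 0#
    square≈0 {z} zz≈0 with z ≟ 0#
    ... | yes p = p
    ... | no ¬p = x*y≈0⇒y≈0 ¬p zz≈0
    x+y≈0⇒x≈y : x + y ≈ 0# → x ≈ y
    x+y≈0⇒x≈y p = Gp.∙-cancelʳ y x y (trans p (sym (characteristic-2 y)))

  unique-square-root : ∀ u → ∃! _≈_ (λ y → y * y ≈ u)
  unique-square-root u with any-element? (λ x≈y p → trans (*-cong (sym x≈y) (sym x≈y)) p)
                                         (λ y → (y * y) ≟ u)
  ... | yes (y , yy≈u) = y , yy≈u , λ zz≈u → square-injective (trans yy≈u (sym zz≈u))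
  ... | no  none       = contradiction
      (λ i eq → none (element i , from-injective (≡.sym eq)))
      (injective⇒hits (λ i → index (element i * element i))
        (λ eq → to-injective (square-injective (from-injective eq))) (index u))
    where
    module E = Inverse enumeration
    from-injective : ∀ {x y} → index x ≡ index y → x ≈ y
    from-injective {x} {y} eq =
      trans (sym (E.strictlyInverseˡ x)) (trans (E.to-cong eq) (E.strictlyInverseˡ y))
    to-injective : ∀ {i j} → element i ≈ element j → i ≡ j
    to-injective {i} {j} eq =
      ≡.trans (≡.sym (E.strictlyInverseʳ i)) (≡.trans (E.from-cong eq) (E.strictlyInverseʳ j))

  √_ : Carrier → Carrier
  √ u = proj₁ (unique-square-root u)

  -- Parity serves as the prime field 𝔽₂, embedded in 𝔽 by ⟦_⟧.
  ⟦_⟧ : Parity → Carrier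
  ⟦ 0ℙ ⟧ = 0#
  ⟦ 1ℙ ⟧ = 1#

  Tr : Carrier → Carrier
  Tr x = ∑𝔽.sum {n} (λ i → x ^ (2 ^ℕ toℕ i))

  H⟨_⟩ : Parity → Pred Carrier ℓ
  H⟨ i ⟩ x = Tr x ≈ ⟦ i ⟧

  -- Lifts 0#, 1# to the exponents 0, 1; it is only applied to traces, which
  -- take no other value.
  exponent : Carrier → ℕ
  exponent t = if does (t ≟ 0#) then 0 else 1

  χ : Carrier → ℤ
  χ x = -1ℤ ℤ.^ exponent (Tr x)

  ∑ : (Carrier → ℤ) → ℤ
  ∑ f = ∑ℤ.sum (λ i → f (element i))

  ∑∈ : ∀ {p} {P : Pred Carrier p} → Decidable P → (Carrier → ℤ) → ℤ
  ∑∈ P? f = ∑ (λ x → if does (P? x) then f x else 0ℤ)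

  F δ : Carrier → Carrier
  F x = x ^ 13
  δ b = F b + F (b + 1#) + 1#

  Δ : Pred Carrier (c ⊔ ℓ)
  Δ t = ∃ λ b → t ≈ δ b

  F-cong : ∀ {x y} → x ≈ y → F x ≈ F y
  F-cong = SemiringExp.^-congˡ semiring 13

  Δ? : Decidable Δ
  Δ? t = any-element?
    (λ x≈y p → trans p (+-congʳ (+-cong (F-cong x≈y) (F-cong (+-congʳ x≈y)))))
    (λ b → t ≟ δ b)

  S : Carrier → ℤ
  S a = ∑∈ Δ? (λ t → χ (a * t))

  H : Carrier → ℤ
  H u = ∑ (λ b → χ (u * δ b))

  -- (X + X²)⁵ / X⁴ is a polynomial without constant term, so its value at 0
  -- is 0; the formula below also gives 0 there, the numerator being 0.
  MCM : Carrier → Carrier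
  MCM x = (x + x ^ 2) ^ 5 * (x ^ 4) ⁻¹

  g : Carrier → Carrier
  g x = x * (x + 1#) ^ 5

  G : Parity → Carrier → ℤ
  G ε u = ∑ (λ s → χ (u * g s + ⟦ ε ⟧ * s))

  Q : Carrier → Carrier → Carrier
  Q u s = Tr (u * s ^ 5 + √ u * s ^ 3)

  V : Carrier → Pred Carrier (c ⊔ ℓ)
  V u w = ∀ s → Q u (s + w) + Q u s + Q u w ≈ 0#

  T : Carrier → Carrier → Carrier
  T u w = Tr (w + u * g w)

  combination : ∀ {d} → (Fin d → Parity) → (Fin d → Carrier) → Carrier
  combination a b = ∑𝔽.sum (λ i → ⟦ a i ⟧ * b i)

  record IsBasis {p} (W : Pred Carrier p) {d : ℕ} (b : Fin d → Carrier) : Set (c ⊔ ℓ ⊔ p) where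
    field
      independent : ∀ a → combination a b ≈ 0# → ∀ i → a i ≡ 0ℙ
      span        : ∀ w → W w ⇔ (∃ λ a → w ≈ combination a b)

  -- W is an 𝔽₂-subspace of 𝔽 with dim W = d.
  HasDimension : ∀ {p} → Pred Carrier p → ℕ → Set (c ⊔ ℓ ⊔ p)
  HasDimension W d = ∃ λ (b : Fin d → Carrier) → IsBasis W b

  Image : ∀ {p} → (Carrier → Carrier) → Pred Carrier p → Pred Carrier (c ⊔ ℓ ⊔ p)
  Image f P y = ∃ λ x → P x × y ≈ f x

  Fiber : (Carrier → Carrier) → Carrier → Pred Carrier ℓ
  Fiber f y x = f x ≈ y

  HasExactlyTwoElements : ∀ {p} → Pred Carrier p → Set (c ⊔ ℓ ⊔ p)
  HasExactlyTwoElements P = ∃₂ λ x₁ x₂ →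
    x₁ ≉ x₂ × P x₁ × P x₂ × (∀ x → P x → x ≈ x₁ ⊎ x ≈ x₂)

  TwoToOne : (Carrier → Carrier) → Set (c ⊔ ℓ)
  TwoToOne f = ∀ y → ∃ (Fiber f y) → HasExactlyTwoElements (Fiber f y)

{-# OPTIONS --safe #-}
module Submission where

-- Since n is odd, x ↦ x⁵ is a bijection, and g(r⁵) = (r⁶ + r)⁵, so the fibres of g are those
-- of r⁶ + r.  For d ≠ 0 the elements r and r + d lie in the same fibre iff D₅(d) = 1, where
-- D₅ = X⁵ + r² X³ + r⁴ X is a Dickson polynomial, which permutes 𝔽.  Hence g is 2-to-1.
-- For x = r⁵ and x′ = (r + d)⁵ one finds (x + x′ + 1)² = d¹⁰ + d⁵, so Tr x′ = Tr x + 1.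
-- The fixed-point-free involution σ : x ↦ x′ reverses the signs in G₁, which gives (i), and
-- δ(b) = g(b² + b) gives (ii) and (iii).  Finally, if T(u,·) vanished on V_u, then the usual
-- squaring of a quadratic exponential sum would yield G₁(u)² = 2ⁿ |V_u| ≠ 0.

open import Algebra.Bundles using (CommutativeMonoid; CommutativeRing)
open import Algebra.Solver.Ring.AlmostCommutativeRing
  using (fromCommutativeRing; _-Raw-AlmostCommutative⟶_)
open import Data.Bool.Base using (if_then_else_)
open import Data.Fin.Base using (Fin; zero; suc; toℕ; inject₁; fromℕ)
open import Data.Fin.Permutation using (Permutation; permutation)
open import Data.Fin.Properties using (toℕ-inject₁; toℕ-fromℕ; suc-injective)
open import Data.Integer.Base using (ℤ; +_; 0ℤ; 1ℤ; -1ℤ) renaming (_*_ to _*ℤ_)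
open import Data.Maybe.Base using (Maybe; just; nothing)
open import Data.Nat.Base using (ℕ; zero; suc; parity; z≤n) renaming (_^_ to _^ℕ_)
open import Data.Parity.Base using (Parity; 0ℙ; 1ℙ)
open import Data.Product using (Σ; ∃; ∃!; _×_; _,_; proj₁; proj₂)
open import Data.Sum.Base as Sum using (_⊎_; inj₁; inj₂; [_,_]′)
open import Function.Base using (id; _∘_)
open import Function.Bundles using (Inverse; Equivalence)
open import Function.Definitions using (Injective)
open import Level using (Level)
open import Relation.Binary.Core using (_Preserves_⟶_)
open import Relation.Binary.PropositionalEquality as ≡ using (_≡_; _≢_)
open import Relation.Nullary using (¬_; Dec; does; yes; no; contradiction)
open import Relation.Nullary.Decidable using (dec-true; dec-false)
open import Relation.Unary using (_≐_)

import Algebra.Properties.CommutativeMonoid.Sum as CommutativeMonoidSum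
import Algebra.Properties.CommutativeSemiring.Exp as CommutativeSemiringExp
import Algebra.Properties.Group as GroupProperties
import Algebra.Properties.Semiring.Exp as SemiringExp
import Algebra.Properties.Semiring.Sum as SemiringSum
import Algebra.Solver.Ring as RingSolver
import Data.Integer.Base as ℤ
import Data.Integer.Properties as ℤₚ
import Data.Parity.Properties as ℙ
import Relation.Binary.Reasoning.Setoid as SetoidReasoning

open import Defs

private
  variable
    c ℓ m ℓm : Level

-- Finite fields: injective self-maps, sums over all elements, the identity x^q = x.

module FiniteFieldProperties {q : ℕ} (𝔽 : FiniteField q c ℓ) where

  open FiniteField 𝔽 hiding (zero)
  private module E = Inverse enumeration

  index-injective : Injective _≈_ _≡_ index
  index-injective {x} {y} eq =
    trans (sym (E.strictlyInverseˡ x)) (trans (E.to-cong eq) (E.strictlyInverseˡ y))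

  element-injective : Injective _≡_ _≈_ element
  element-injective {i} {j} eq =
    ≡.trans (≡.sym (E.strictlyInverseʳ i)) (≡.trans (E.from-cong eq) (E.strictlyInverseʳ j))

  *-cancelˡ-≉0 : ∀ {x y z} → x ≉ 0# → x * y ≈ x * z → y ≈ z
  *-cancelˡ-≉0 {x} {y} {z} x≉0 xy≈xz with inverse x x≉0
  ... | w , xw≈1 = begin
    y           ≈⟨ cancel y ⟩
    w * (x * y) ≈⟨ *-congˡ xy≈xz ⟩
    w * (x * z) ≈⟨ cancel z ⟨
    z           ∎
    where
    open SetoidReasoning setoid
    cancel : ∀ v → v ≈ w * (x * v)
    cancel v = begin
      v           ≈⟨ *-identityˡ v ⟨
      1# * v      ≈⟨ *-congʳ (trans (*-comm w x) xw≈1) ⟨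
      w * x * v   ≈⟨ *-assoc w x v ⟩
      w * (x * v) ∎

  *-≉0 : ∀ {x y} → x ≉ 0# → y ≉ 0# → x * y ≉ 0#
  *-≉0 x≉0 y≉0 = y≉0 ∘ x*y≈0⇒y≈0 x≉0

  module _ {φ : Carrier → Carrier} (φ-cong : φ Preserves _≈_ ⟶ _≈_)
           (φ-injective : Injective _≈_ _≈_ φ) where

    -- Pigeonhole: `_≈_` is decidable on a finite carrier, so a preimage can be searched for; a
    -- failed search would give an injective self-map of `Fin q` that misses an index.
    injective⇒surjective : ∀ y → ∃ λ x → φ x ≈ y
    injective⇒surjective y
      with any-element? (λ x≈x′ p → trans (φ-cong (sym x≈x′)) p) (λ x → φ x ≟ y)
    ... | yes hit = hit
    ... | no none = contradiction
      (λ i eq → none (element i , sym (index-injective eq)))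
      (injective⇒hits (index ∘ φ ∘ element)
        (element-injective ∘ φ-injective ∘ index-injective) (index y))

    private
      ψ : Carrier → Carrier
      ψ = proj₁ ∘ injective⇒surjective

      φψ : ∀ y → φ (ψ y) ≈ y
      φψ = proj₂ ∘ injective⇒surjective

    injective⇒permutation : Permutation q q
    injective⇒permutation = permutation (index ∘ φ ∘ element) (index ∘ ψ ∘ element)
      (λ i → element-injective (trans (E.strictlyInverseˡ _)
        (trans (φ-cong (E.strictlyInverseˡ _)) (φψ _))))
      (λ i → element-injective (trans (E.strictlyInverseˡ _)
        (φ-injective (trans (φψ _) (E.strictlyInverseˡ _)))))

  module _ (M : CommutativeMonoid m ℓm) where
    private module M = CommutativeMonoid M
    open CommutativeMonoidSum M

    private
      sum-single : ∀ {k} (t : Fin k → M.Carrier) i → (∀ j → j ≢ i → t j M.≈ M.ε) →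
                   sum t M.≈ t i
      sum-single {suc k} t zero t≈ε = M.trans
        (M.∙-congˡ (M.trans (sum-cong-≋ (λ j → t≈ε (suc j) λ ())) (sum-replicate-zero k)))
        (M.identityʳ _)
      sum-single t (suc i) t≈ε = M.trans
        (M.∙-cong (t≈ε zero λ ()) (sum-single (t ∘ suc) i (λ j j≢i → t≈ε (suc j) (j≢i ∘ suc-injective))))
        (M.identityˡ _)

    module _ {f : Carrier → M.Carrier} (f-cong : f Preserves _≈_ ⟶ M._≈_) where

      sum-supported-at : ∀ a → (∀ x → x ≉ a → f x M.≈ M.ε) → sum (f ∘ element) M.≈ f a
      sum-supported-at a f≈ε = M.trans
        (sum-single (f ∘ element) (index a)
          (λ j j≢a → f≈ε (element j) (λ eq → j≢a (≡.trans (≡.sym (E.strictlyInverseʳ j)) (E.from-cong eq)))))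
        (f-cong (E.strictlyInverseˡ a))

      -- Change of variables in a sum over the field. Finiteness makes injectivity of `φ` enough to
      -- get a permutation.
      sum-reindex : ∀ {φ} → φ Preserves _≈_ ⟶ _≈_ → Injective _≈_ _≈_ φ →
                    sum (f ∘ φ ∘ element) M.≈ sum (f ∘ element)
      sum-reindex φ-cong φ-injective = M.sym (M.trans
        (sum-permute (f ∘ element) (injective⇒permutation φ-cong φ-injective))
        (sum-cong-≋ {q} (λ i → f-cong (E.strictlyInverseˡ _))))

  open CommutativeSemiringExp commutativeSemiring using (_^_)
  private module ∏ = CommutativeMonoidSum *-commutativeMonoid

  -- Multiplication by x permutes the nonzero elements, whence x^(q-1) = 1.
  x^q≈x : ∀ x → x ^ q ≈ x
  x^q≈x x with x ≟ 0#
  -- Here `x ^ q` vanishes only because q is positive; the index of `0#` in `Fin q` witnesses this.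
  ... | yes x≈0 = 0^ (index 0#)
    where
    0^ : ∀ {k} → Fin k → x ^ k ≈ x
    0^ {suc k} _ = trans (*-congʳ x≈0) (trans (zeroˡ _) (sym x≈0))
  ... | no x≉0 = begin
    x ^ q                                              ≈⟨ ∏.sum-replicate q ⟨
    ∏.sum {q} (λ _ → x)                                ≈⟨ ∏.sum-cong-≋ (onUnits*at0≈x ∘ element) ⟨
    ∏.sum (λ i → onUnits (element i) * at0 (element i)) ≈⟨ ∏.∑-distrib-+ (onUnits ∘ element) (at0 ∘ element) ⟩
    ∏.sum (onUnits ∘ element) * ∏.sum (at0 ∘ element)   ≈⟨ *-cong ∏onUnits≈1 ∏at0≈x ⟩
    1# * x                                             ≈⟨ *-identityˡ x ⟩
    x                                                  ∎
    where
    open SetoidReasoning setoid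

    -- The q constant factors x are split into a factor at 0 (`at0`) and those at the nonzero
    -- elements (`onUnits`). `unit` replaces 0 by 1, so the product of all its values is nonzero and
    -- can be cancelled.
    onUnits at0 unit : Carrier → Carrier
    onUnits y with y ≟ 0#
    ... | yes _ = 1#
    ... | no  _ = x
    at0 y with y ≟ 0#
    ... | yes _ = x
    ... | no  _ = 1#
    unit y with y ≟ 0#
    ... | yes _ = 1#
    ... | no  _ = y

    onUnits*at0≈x : ∀ y → onUnits y * at0 y ≈ x
    onUnits*at0≈x y with y ≟ 0#
    ... | yes _ = *-identityˡ x
    ... | no  _ = *-identityʳ x

    at0-cong : at0 Preserves _≈_ ⟶ _≈_
    at0-cong {y} {z} y≈z with y ≟ 0# | z ≟ 0#
    ... | yes _ | yes _ = refl
    ... | no  _ | no  _ = refl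
    ... | yes p | no  q = contradiction (trans (sym y≈z) p) q
    ... | no  p | yes q = contradiction (trans y≈z q) p

    unit-cong : unit Preserves _≈_ ⟶ _≈_
    unit-cong {y} {z} y≈z with y ≟ 0# | z ≟ 0#
    ... | yes _ | yes _ = refl
    ... | no  _ | no  _ = y≈z
    ... | yes p | no  q = contradiction (trans (sym y≈z) p) q
    ... | no  p | yes q = contradiction (trans y≈z q) p

    ∏at0≈x : ∏.sum (at0 ∘ element) ≈ x
    ∏at0≈x = trans (sum-supported-at *-commutativeMonoid at0-cong 0# off) at
      where
      off : ∀ y → y ≉ 0# → at0 y ≈ 1#
      off y y≉0 with y ≟ 0#
      ... | yes p = contradiction p y≉0
      ... | no  _ = refl
      at : at0 0# ≈ x
      at with 0# ≟ 0#
      ... | yes _ = refl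
      ... | no ¬p = contradiction refl ¬p

    unit-* : ∀ y → unit (x * y) ≈ unit y * onUnits y
    unit-* y with (x * y) ≟ 0# | y ≟ 0#
    ... | yes _ | yes _ = sym (*-identityˡ 1#)
    ... | no  _ | no  _ = *-comm x y
    ... | yes p | no  q = contradiction (x*y≈0⇒y≈0 x≉0 p) q
    ... | no  p | yes q = contradiction (trans (*-congˡ q) (zeroʳ x)) p

    ∏unit≉0 : ∀ {k} (t : Fin k → Carrier) → ∏.sum (unit ∘ t) ≉ 0#
    ∏unit≉0 {zero}  t eq = 0≉1 (sym eq)
    ∏unit≉0 {suc k} t    = *-≉0 (unit≉0 (t zero)) (∏unit≉0 (t ∘ suc))
      where
      unit≉0 : ∀ y → unit y ≉ 0#
      unit≉0 y with y ≟ 0#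
      ... | yes _ = 0≉1 ∘ sym
      ... | no ¬p = ¬p

    ∏onUnits≈1 : ∏.sum (onUnits ∘ element) ≈ 1#
    ∏onUnits≈1 = *-cancelˡ-≉0 (∏unit≉0 element) (begin
      ∏.sum (unit ∘ element) * ∏.sum (onUnits ∘ element)    ≈⟨ ∏.∑-distrib-+ (unit ∘ element) (onUnits ∘ element) ⟨
      ∏.sum (λ i → unit (element i) * onUnits (element i))  ≈⟨ ∏.sum-cong-≋ (unit-* ∘ element) ⟨
      ∏.sum (unit ∘ (x *_) ∘ element)                       ≈⟨ sum-reindex *-commutativeMonoid unit-cong *-congˡ (*-cancelˡ-≉0 x≉0) ⟩
      ∏.sum (unit ∘ element)                                ≈⟨ *-identityʳ _ ⟨
      ∏.sum (unit ∘ element) * 1#                           ∎)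

-- Characteristic 2: the trace, the additive character, and `g` as a polynomial.

module BinaryFieldProperties {n : ℕ} (𝔽 : FiniteField (2 ^ℕ n) c ℓ) where

  open BinaryField {n} 𝔽 hiding (zero)
  open GroupProperties +-group using (inverseʳ-unique; ε⁻¹≈ε; ∙-cancelˡ; ∙-cancelʳ)
  open FiniteFieldProperties 𝔽

  private
    -- Gives the ring solver coefficients in 𝔽₂, so that even coefficients disappear during
    -- normalisation and identities special to characteristic 2 hold by `refl`.
    𝔽₂⟶𝔽 : CommutativeRing.rawRing ℙ.+-*-commutativeRing
            -Raw-AlmostCommutative⟶ fromCommutativeRing commutativeRing
    𝔽₂⟶𝔽 = record
      { ⟦_⟧    = ⟦_⟧
      ; +-homo = λ where
          0ℙ b  → sym (+-identityˡ _)
          1ℙ 0ℙ → sym (+-identityʳ _)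
          1ℙ 1ℙ → sym (characteristic-2 1#)
      ; *-homo = λ where
          0ℙ b  → sym (zeroˡ _)
          1ℙ b  → sym (*-identityˡ _)
      ; -‿homo = λ where
          0ℙ → sym ε⁻¹≈ε
          1ℙ → inverseʳ-unique 1# 1# (characteristic-2 1#)
      ; 0-homo = refl
      ; 1-homo = refl
      }

    _≟₂_ : ∀ a b → Maybe (⟦ a ⟧ ≈ ⟦ b ⟧)
    0ℙ ≟₂ 0ℙ = just refl
    1ℙ ≟₂ 1ℙ = just refl
    0ℙ ≟₂ 1ℙ = nothing
    1ℙ ≟₂ 0ℙ = nothing

  open RingSolver (CommutativeRing.rawRing ℙ.+-*-commutativeRing)
    (fromCommutativeRing commutativeRing) 𝔽₂⟶𝔽 _≟₂_
    public using (solve; _:=_; _:+_; _:*_; _:^_; con)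

  private
    open CommutativeSemiringExp commutativeSemiring using (^-congˡ; ^-assocʳ; ^-distrib-*)
    module ≈-Reasoning = SetoidReasoning setoid
    module ∑𝔽 = CommutativeMonoidSum +-commutativeMonoid
    module ∑ℤ = SemiringSum ℤₚ.+-*-semiring

  x+y≈0⇒x≈y : ∀ {x y} → x + y ≈ 0# → x ≈ y
  x+y≈0⇒x≈y {x} {y} eq = ∙-cancelʳ y x y (trans eq (sym (characteristic-2 y)))

  x+y≈z⇒x≈y+z : ∀ {x y z} → x + y ≈ z → x ≈ y + z
  x+y≈z⇒x≈y+z {x} {y} {z} eq = trans
    (solve 2 (λ x y → x := y :+ (x :+ y)) refl x y) (+-congˡ eq)

  x^2≈x*x : ∀ x → x ^ 2 ≈ x * x
  x^2≈x*x x = *-congˡ (*-identityʳ x)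

  x*x≈0⇒x≈0 : ∀ {x} → x * x ≈ 0# → x ≈ 0#
  x*x≈0⇒x≈0 xx≈0 = square-injective (trans xx≈0 (sym (zeroˡ 0#)))

  ^2^-distrib-+ : ∀ i x y → (x + y) ^ (2 ^ℕ i) ≈ x ^ (2 ^ℕ i) + y ^ (2 ^ℕ i)
  ^2^-distrib-+ zero    x y = distribʳ 1# x y
  ^2^-distrib-+ (suc i) x y = begin
    (x + y) ^ (2 ^ℕ suc i)             ≈⟨ ^-assocʳ (x + y) 2 (2 ^ℕ i) ⟨
    ((x + y) ^ 2) ^ (2 ^ℕ i)           ≈⟨ ^-congˡ (2 ^ℕ i) (solve 2 (λ x y → (x :+ y) :^ 2 := x :^ 2 :+ y :^ 2) refl x y) ⟩
    (x ^ 2 + y ^ 2) ^ (2 ^ℕ i)         ≈⟨ ^2^-distrib-+ i (x ^ 2) (y ^ 2) ⟩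
    (x ^ 2) ^ (2 ^ℕ i) + (y ^ 2) ^ (2 ^ℕ i) ≈⟨ +-cong (^-assocʳ x 2 (2 ^ℕ i)) (^-assocʳ y 2 (2 ^ℕ i)) ⟩
    x ^ (2 ^ℕ suc i) + y ^ (2 ^ℕ suc i) ∎
    where open ≈-Reasoning

  Tr-cong : Tr Preserves _≈_ ⟶ _≈_
  Tr-cong x≈y = ∑𝔽.sum-cong-≋ {n} (λ i → ^-congˡ (2 ^ℕ toℕ i) x≈y)

  Tr-+ : ∀ x y → Tr (x + y) ≈ Tr x + Tr y
  Tr-+ x y = trans (∑𝔽.sum-cong-≋ {n} (λ i → ^2^-distrib-+ (toℕ i) x y))
    (∑𝔽.∑-distrib-+ {n} (λ i → x ^ (2 ^ℕ toℕ i)) (λ i → y ^ (2 ^ℕ toℕ i)))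

  Tr-0# : Tr 0# ≈ 0#
  Tr-0# = begin
    Tr 0#         ≈⟨ Tr-cong (+-identityʳ 0#) ⟨
    Tr (0# + 0#)  ≈⟨ Tr-+ 0# 0# ⟩
    Tr 0# + Tr 0# ≈⟨ characteristic-2 (Tr 0#) ⟩
    0#            ∎
    where open ≈-Reasoning

  -- Squaring shifts the n conjugates of x by one. The n + 1 powers x^(2^i), i = 0, ..., n, are
  -- summed by splitting off either the first or the last; the last is x again by `x^q≈x`.
  Tr-x*x : ∀ x → Tr (x * x) ≈ Tr x
  Tr-x*x x = ∙-cancelˡ x _ _ (begin
    x + Tr (x * x)                             ≈⟨ +-cong (*-identityʳ x) (∑𝔽.sum-cong-≋ {n} (λ i → square^ (toℕ i))) ⟨
    x ^ 1 + ∑𝔽.sum {n} (λ i → a (suc i))      ≈⟨ ∑𝔽.sum-init-last a ⟩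
    ∑𝔽.sum {n} (λ i → a (inject₁ i)) + a (fromℕ n)
      ≡⟨ ≡.cong₂ _+_ (∑𝔽.sum-cong-≗ {n} (λ i → ≡.cong (λ k → x ^ (2 ^ℕ k)) (toℕ-inject₁ i)))
                     (≡.cong (λ k → x ^ (2 ^ℕ k)) (toℕ-fromℕ n)) ⟩
    Tr x + x ^ (2 ^ℕ n)                       ≈⟨ +-congˡ (x^q≈x x) ⟩
    Tr x + x                                   ≈⟨ +-comm (Tr x) x ⟩
    x + Tr x                                   ∎)
    where
    open ≈-Reasoning
    a : Fin (suc n) → Carrier
    a i = x ^ (2 ^ℕ toℕ i)
    square^ : ∀ k → x ^ (2 ^ℕ suc k) ≈ (x * x) ^ (2 ^ℕ k)
    square^ k = trans (sym (^-assocʳ x 2 (2 ^ℕ k))) (^-congˡ (2 ^ℕ k) (x^2≈x*x x))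

  -- Squaring is additive, so the square of a trace is the trace of the square. The trace is thus a
  -- root of X² + X, which confines it to 0 and 1.
  Tr*Tr≈Tr : ∀ x → Tr x * Tr x ≈ Tr x
  Tr*Tr≈Tr x = begin
    Tr x * Tr x                                                     ≈⟨ square-sum {n} (λ i → x ^ (2 ^ℕ toℕ i)) ⟩
    ∑𝔽.sum {n} (λ i → x ^ (2 ^ℕ toℕ i) * x ^ (2 ^ℕ toℕ i))        ≈⟨ ∑𝔽.sum-cong-≋ {n} (λ i → ^-distrib-* x x (2 ^ℕ toℕ i)) ⟨
    Tr (x * x)                                                      ≈⟨ Tr-x*x x ⟩
    Tr x                                                            ∎
    where
    open ≈-Reasoning
    square-sum : ∀ {k} (t : Fin k → Carrier) → ∑𝔽.sum t * ∑𝔽.sum t ≈ ∑𝔽.sum (λ i → t i * t i)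
    square-sum {zero}  t = zeroˡ 0#
    square-sum {suc k} t = trans
      (solve 2 (λ x y → (x :+ y) :* (x :+ y) := x :* x :+ y :* y) refl (t zero) (∑𝔽.sum (t ∘ suc)))
      (+-congˡ (square-sum (t ∘ suc)))

  Tr≈0⊎Tr≈1 : ∀ x → Tr x ≈ 0# ⊎ Tr x ≈ 1#
  Tr≈0⊎Tr≈1 x with Tr x ≟ 0#
  ... | yes Tr≈0 = inj₁ Tr≈0
  ... | no  Tr≉0 = inj₂ (*-cancelˡ-≉0 Tr≉0 (trans (Tr*Tr≈Tr x) (sym (*-identityʳ (Tr x)))))

  Tr[x*x+x]≈0 : ∀ x → Tr (x * x + x) ≈ 0#
  Tr[x*x+x]≈0 x = begin
    Tr (x * x + x)    ≈⟨ Tr-+ (x * x) x ⟩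
    Tr (x * x) + Tr x ≈⟨ +-congʳ (Tr-x*x x) ⟩
    Tr x + Tr x       ≈⟨ characteristic-2 (Tr x) ⟩
    0#                ∎
    where open ≈-Reasoning

  Tr-apart : ∀ {x y} → Tr x ≉ Tr y → Tr x ≈ Tr y + 1#
  Tr-apart {x} {y} Trx≉Try = x+y≈z⇒x≈y+z (trans (sym (Tr-+ x y)) Tr[x+y]≈1)
    where
    Tr[x+y]≈1 : Tr (x + y) ≈ 1#
    Tr[x+y]≈1 with Tr≈0⊎Tr≈1 (x + y)
    ... | inj₁ eq = contradiction (x+y≈0⇒x≈y (trans (sym (Tr-+ x y)) eq)) Trx≉Try
    ... | inj₂ eq = eq

  χ≡1 : ∀ {x} → Tr x ≈ 0# → χ x ≡ 1ℤ
  χ≡1 {x} Tr≈0 =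
    ≡.cong (λ b → -1ℤ ℤ.^ (if b then 0 else 1)) (dec-true (Tr x ≟ 0#) Tr≈0)

  χ≡-1 : ∀ {x} → Tr x ≈ 1# → χ x ≡ -1ℤ
  χ≡-1 {x} Tr≈1 =
    ≡.cong (λ b → -1ℤ ℤ.^ (if b then 0 else 1))
      (dec-false (Tr x ≟ 0#) (λ Tr≈0 → 0≉1 (trans (sym Tr≈0) Tr≈1)))

  χ-cong : χ Preserves _≈_ ⟶ _≡_
  χ-cong {x} {y} x≈y with Tr≈0⊎Tr≈1 y
  ... | inj₁ Tr≈0 = ≡.trans (χ≡1 (trans (Tr-cong x≈y) Tr≈0)) (≡.sym (χ≡1 Tr≈0))
  ... | inj₂ Tr≈1 = ≡.trans (χ≡-1 (trans (Tr-cong x≈y) Tr≈1)) (≡.sym (χ≡-1 Tr≈1))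

  χ-+ : ∀ x y → χ (x + y) ≡ χ x *ℤ χ y
  χ-+ x y with Tr≈0⊎Tr≈1 x | Tr≈0⊎Tr≈1 y
  ... | inj₁ p | inj₁ q rewrite χ≡1 p | χ≡1 q =
    χ≡1 (trans (Tr-+ x y) (trans (+-cong p q) (+-identityˡ 0#)))
  ... | inj₁ p | inj₂ q rewrite χ≡1 p | χ≡-1 q =
    χ≡-1 (trans (Tr-+ x y) (trans (+-cong p q) (+-identityˡ 1#)))
  ... | inj₂ p | inj₁ q rewrite χ≡-1 p | χ≡1 q =
    χ≡-1 (trans (Tr-+ x y) (trans (+-cong p q) (+-identityʳ 1#)))
  ... | inj₂ p | inj₂ q rewrite χ≡-1 p | χ≡-1 q =
    χ≡1 (trans (Tr-+ x y) (trans (+-cong p q) (characteristic-2 1#)))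

  ∑-cong : ∀ {f h} → (∀ x → f x ≡ h x) → ∑ f ≡ ∑ h
  ∑-cong f≗h = ∑ℤ.sum-cong-≗ (f≗h ∘ element)

  ∑-reindex : ∀ {f φ} → f Preserves _≈_ ⟶ _≡_ → φ Preserves _≈_ ⟶ _≈_ →
              Injective _≈_ _≈_ φ → ∑ (f ∘ φ) ≡ ∑ f
  ∑-reindex f-cong φ-cong = sum-reindex ℤₚ.+-0-commutativeMonoid f-cong φ-cong

  -- Reindexing by `φ` shows that the sum is its own negative, and ℤ has no 2-torsion. It serves
  -- both for `σ` and for translations.
  ∑-sign-reversing : ∀ {f φ} → f Preserves _≈_ ⟶ _≡_ → φ Preserves _≈_ ⟶ _≈_ →
                     Injective _≈_ _≈_ φ → (∀ x → f (φ x) ≡ -1ℤ *ℤ f x) → ∑ f ≡ 0ℤ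
  ∑-sign-reversing {f} {φ} f-cong φ-cong φ-injective fφ≡-f = i≡-i⇒i≡0 (begin
    ∑ f                    ≡⟨ ∑-reindex f-cong φ-cong φ-injective ⟨
    ∑ (f ∘ φ)              ≡⟨ ∑-cong fφ≡-f ⟩
    ∑ (λ x → -1ℤ *ℤ f x)  ≡⟨ ∑ℤ.*-distribˡ-sum -1ℤ (f ∘ element) ⟨
    -1ℤ *ℤ ∑ f            ≡⟨ ℤₚ.-1*i≡-i (∑ f) ⟩
    ℤ.- ∑ f               ∎)
    where
    open ≡.≡-Reasoning
    i≡-i⇒i≡0 : ∀ {i} → i ≡ ℤ.- i → i ≡ 0ℤ
    i≡-i⇒i≡0 {+ zero} _ = ≡.refl

  g-cong : g Preserves _≈_ ⟶ _≈_
  g-cong x≈y = *-cong x≈y (^-congˡ 5 (+-congʳ x≈y))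

  -- A polynomial identity over 𝔽₂. It ties the derivative of x¹³ to `g`, evaluated at arguments of
  -- trace 0.
  δ≈g[b*b+b] : ∀ b → δ b ≈ g (b * b + b)
  δ≈g[b*b+b] = solve 1 (λ b → b :^ 13 :+ (b :+ con 1ℙ) :^ 13 :+ con 1ℙ :=
    (b :* b :+ b) :* (b :* b :+ b :+ con 1ℙ) :^ 5) refl

  g≈MCM : ∀ x → g x ≈ MCM x
  g≈MCM x with (x ^ 4) ≟ 0#
  -- This is the test that `_⁻¹` itself performs: in this branch the inverse takes its default value
  -- 0, and `g x` vanishes too because x = 0.
  ... | yes x⁴≈0 = trans (trans (*-congʳ x≈0) (zeroˡ _)) (sym (zeroʳ _))
    where
    x≈0 : x ≈ 0#
    x≈0 = x*x≈0⇒x≈0 (x*x≈0⇒x≈0 (trans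
      (solve 1 (λ x → (x :* x) :* (x :* x) := x :^ 4) refl x) x⁴≈0))
  ... | no  x⁴≉0 with inverse (x ^ 4) x⁴≉0
  ...   | i , x⁴i≈1 = begin
    g x                   ≈⟨ *-identityʳ (g x) ⟨
    g x * 1#              ≈⟨ *-congˡ x⁴i≈1 ⟨
    g x * (x ^ 4 * i)     ≈⟨ solve 2 (λ x i → x :* (x :+ con 1ℙ) :^ 5 :* (x :^ 4 :* i) :=
                                (x :+ x :^ 2) :^ 5 :* i) refl x i ⟩
    (x + x ^ 2) ^ 5 * i   ∎
    where open ≈-Reasoning

-- Odd degree: the Dickson polynomial and the fibres of `g`.

module OddDegree {n : ℕ} (odd : parity n ≡ 1ℙ) (𝔽 : FiniteField (2 ^ℕ n) c ℓ) where

  open BinaryField {n} 𝔽 hiding (zero)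
  open FiniteFieldProperties 𝔽
  open BinaryFieldProperties {n = n} 𝔽

  private
    open SemiringExp semiring using (^-congˡ)
    open GroupProperties +-group using (∙-cancelʳ)
    module ≈-Reasoning = SetoidReasoning setoid
    module ∑𝔽 = CommutativeMonoidSum +-commutativeMonoid
    module ∑ℤ = SemiringSum ℤₚ.+-*-semiring

  -- The trace of 1 is n copies of 1. This is where the oddness of n enters; the later arguments
  -- draw on it through this equation.
  Tr-1# : Tr 1# ≈ 1#
  Tr-1# = trans (∑𝔽.sum-cong-≋ {n} (λ i → 1^ (2 ^ℕ toℕ i))) (sum-1# n odd)
    where
    1^ : ∀ k → 1# ^ k ≈ 1#
    1^ zero    = refl
    1^ (suc k) = trans (*-identityˡ _) (1^ k)
    sum-1# : ∀ k → parity k ≡ 1ℙ → ∑𝔽.sum {k} (λ _ → 1#) ≈ 1#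
    sum-1# (suc zero)    _   = +-identityʳ 1#
    sum-1# (suc (suc k)) odd = trans (+-congˡ (+-congˡ (sum-1# k odd)))
      (solve 0 (con 1ℙ :+ (con 1ℙ :+ con 1ℙ) := con 1ℙ) refl)

  Tr-⟦⟧ : ∀ i → Tr ⟦ i ⟧ ≈ ⟦ i ⟧
  Tr-⟦⟧ 0ℙ = Tr-0#
  Tr-⟦⟧ 1ℙ = Tr-1#

  -- The two sides have different traces. So X² + X + 1 has no root: the field contains no primitive
  -- cube root of unity.
  x*x+x≉1 : ∀ x → x * x + x ≉ 1#
  x*x+x≉1 x eq = 0≉1 (begin
    0#              ≈⟨ Tr[x*x+x]≈0 x ⟨
    Tr (x * x + x)  ≈⟨ Tr-cong eq ⟩
    Tr 1#           ≈⟨ Tr-1# ⟩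
    1#              ∎)
    where open ≈-Reasoning

  -- The form is the norm from 𝔽(ω), where ω² + ω + 1 = 0: since n is odd, ω ∉ 𝔽.
  norm-anisotropic : ∀ {x y} → x * x + x * y + y * y ≈ 0# → x ≈ 0# × y ≈ 0#
  norm-anisotropic {x} {y} N≈0 with y ≟ 0#
  ... | yes y≈0 = x*x≈0⇒x≈0 (begin
    x * x                                 ≈⟨ solve 2 (λ x y → x :* x := (x :* x :+ x :* y :+ y :* y) :+ (x :+ y) :* y) refl x y ⟩
    (x * x + x * y + y * y) + (x + y) * y ≈⟨ +-cong N≈0 (trans (*-congˡ y≈0) (zeroʳ _)) ⟩
    0# + 0#                               ≈⟨ +-identityʳ 0# ⟩
    0#                                    ∎) , y≈0
    where open ≈-Reasoning
  ... | no  y≉0 with inverse y y≉0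
  -- With z = 1/y, dividing the form by y² would make x/y a root of X² + X + 1.
  ...   | z , yz≈1 = contradiction (begin
    (x * z) * (x * z) + x * z  ≈⟨ solve 3 (λ x y z → (x :* z) :* (x :* z) :+ x :* z :=
                                    (x :* x :+ x :* y :+ y :* y) :* (z :* z) :+ (y :* z) :* (y :* z)
                                      :+ x :* z :* (y :* z :+ con 1ℙ)) refl x y z ⟩
    (x * x + x * y + y * y) * (z * z) + (y * z) * (y * z) + x * z * (y * z + 1#)
                               ≈⟨ +-cong (+-cong (*-congʳ N≈0) (*-cong yz≈1 yz≈1)) (*-congˡ (+-congʳ yz≈1)) ⟩
    0# * (z * z) + 1# * 1# + x * z * (1# + 1#)
                               ≈⟨ solve 2 (λ x z → con 0ℙ :* (z :* z) :+ con 1ℙ :* con 1ℙ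
                                      :+ x :* z :* (con 1ℙ :+ con 1ℙ) := con 1ℙ) refl x z ⟩
    1#                         ∎) (x*x+x≉1 (x * z))
    where open ≈-Reasoning

  -- The Dickson polynomial of degree 5 in characteristic 2.
  D₅ : Carrier → Carrier → Carrier
  D₅ a x = x ^ 5 + a * x ^ 3 + a ^ 2 * x

  D₅-cong : ∀ {a} → D₅ a Preserves _≈_ ⟶ _≈_
  D₅-cong x≈y = +-cong (+-cong (^-congˡ 5 x≈y) (*-congˡ (^-congˡ 3 x≈y))) (*-congˡ x≈y)

  -- Write N for the norm form X² + XY + Y². Then D₅(x) + D₅(y) = (x + y) N(p, r). If x ≠ y,
  -- anisotropy gives p = r = 0; but p + r = N(x, y), so anisotropy again gives x = y = 0.
  D₅-injective : ∀ {a} → Injective _≈_ _≈_ (D₅ a)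
  D₅-injective {a} {x} {y} eq with (x + y) ≟ 0#
  ... | yes x+y≈0 = x+y≈0⇒x≈y x+y≈0
  ... | no  x+y≉0 = trans x≈0 (sym y≈0)
    where
    open ≈-Reasoning
    p r : Carrier
    p = x * x + y * y + a
    r = x * y + a
    p≈0×r≈0 : p ≈ 0# × r ≈ 0#
    p≈0×r≈0 = norm-anisotropic (x*y≈0⇒y≈0 x+y≉0 (begin
      (x + y) * (p * p + p * r + r * r)
        ≈⟨ solve 3 (λ a x y → let p = x :* x :+ y :* y :+ a ; r = x :* y :+ a in
             (x :+ y) :* (p :* p :+ p :* r :+ r :* r) :=
             (x :^ 5 :+ a :* x :^ 3 :+ a :^ 2 :* x) :+ (y :^ 5 :+ a :* y :^ 3 :+ a :^ 2 :* y)) refl a x y ⟩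
      D₅ a x + D₅ a y ≈⟨ +-congʳ eq ⟩
      D₅ a y + D₅ a y ≈⟨ characteristic-2 (D₅ a y) ⟩
      0#              ∎))
    x≈0×y≈0 : x ≈ 0# × y ≈ 0#
    x≈0×y≈0 = norm-anisotropic (begin
      x * x + x * y + y * y ≈⟨ solve 3 (λ a x y → x :* x :+ x :* y :+ y :* y :=
                                 (x :* x :+ y :* y :+ a) :+ (x :* y :+ a)) refl a x y ⟩
      p + r                 ≈⟨ +-cong (proj₁ p≈0×r≈0) (proj₂ p≈0×r≈0) ⟩
      0# + 0#               ≈⟨ +-identityʳ 0# ⟩
      0#                    ∎)
    x≈0 = proj₁ x≈0×y≈0
    y≈0 = proj₂ x≈0×y≈0

  -- Fifth powers are the degenerate case a = 0 of the Dickson polynomial.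
  ^5-injective : Injective _≈_ _≈_ (_^ 5)
  ^5-injective {x} {y} eq = D₅-injective (trans (D₅0≈^5 x) (trans eq (sym (D₅0≈^5 y))))
    where
    D₅0≈^5 : ∀ x → D₅ 0# x ≈ x ^ 5
    D₅0≈^5 = solve 1 (λ x → x :^ 5 :+ con 0ℙ :* x :^ 3 :+ con 0ℙ :^ 2 :* x := x :^ 5) refl

  ⁵√ : ∀ x → ∃ λ r → r ^ 5 ≈ x
  ⁵√ = injective⇒surjective (^-congˡ 5) ^5-injective

  g[r^5]≈[r^6+r]^5 : ∀ r → g (r ^ 5) ≈ (r ^ 6 + r) ^ 5
  g[r^5]≈[r^6+r]^5 = solve 1 (λ r → r :^ 5 :* (r :^ 5 :+ con 1ℙ) :^ 5 := (r :^ 6 :+ r) :^ 5) refl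

  -- Geometrically: x⁶ is the o-polynomial of Segre's hyperoval, so lines meet its graph in 0 or 2 points.
  r^6+r-shift : ∀ r d → (r + d) ^ 6 + (r + d) ≈ (r ^ 6 + r) + d * (D₅ (r ^ 2) d + 1#)
  r^6+r-shift = solve 2 (λ r d → (r :+ d) :^ 6 :+ (r :+ d) :=
    (r :^ 6 :+ r) :+ d :* ((d :^ 5 :+ r :^ 2 :* d :^ 3 :+ (r :^ 2) :^ 2 :* d) :+ con 1ℙ)) refl

  module _ {r d : Carrier} (D≈1 : D₅ (r ^ 2) d ≈ 1#) where

    private
      D+1≈0 : D₅ (r ^ 2) d + 1# ≈ 0#
      D+1≈0 = trans (+-congʳ D≈1) (characteristic-2 1#)

    g[r+d]≈g[r] : g ((r + d) ^ 5) ≈ g (r ^ 5)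
    g[r+d]≈g[r] = begin
      g ((r + d) ^ 5)               ≈⟨ g[r^5]≈[r^6+r]^5 (r + d) ⟩
      ((r + d) ^ 6 + (r + d)) ^ 5   ≈⟨ ^-congˡ 5 (trans (r^6+r-shift r d) (trans
                                          (+-congˡ (trans (*-congˡ D+1≈0) (zeroʳ d))) (+-identityʳ _))) ⟩
      (r ^ 6 + r) ^ 5               ≈⟨ g[r^5]≈[r^6+r]^5 r ⟨
      g (r ^ 5)                     ∎
      where open ≈-Reasoning

    -- Once `^5-injective` has removed the fifth powers, the shift identity with increment r + t
    -- gives (r + t)(D₅(r + t) + 1) = 0. For t ≠ r, injectivity of `D₅` forces r + t = d.
    g-fiber : ∀ t → g (t ^ 5) ≈ g (r ^ 5) → t ≈ r ⊎ t ≈ r + d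
    g-fiber t eq with (r + t) ≟ 0#
    ... | yes r+t≈0 = inj₁ (sym (x+y≈0⇒x≈y r+t≈0))
    ... | no  r+t≉0 = inj₂ (trans (t≈r+[r+t]) (+-congˡ (D₅-injective (trans D[r+t]≈1 (sym D≈1)))))
      where
      open ≈-Reasoning
      t≈r+[r+t] : t ≈ r + (r + t)
      t≈r+[r+t] = solve 2 (λ r t → t := r :+ (r :+ t)) refl r t
      D[r+t]≈1 : D₅ (r ^ 2) (r + t) ≈ 1#
      D[r+t]≈1 = x+y≈0⇒x≈y (x*y≈0⇒y≈0 r+t≉0 (begin
        (r + t) * (D₅ (r ^ 2) (r + t) + 1#)
          ≈⟨ solve 2 (λ r t → (r :+ t) :* (((r :+ t) :^ 5 :+ r :^ 2 :* (r :+ t) :^ 3 :+ (r :^ 2) :^ 2 :* (r :+ t)) :+ con 1ℙ)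
               := (t :^ 6 :+ t) :+ (r :^ 6 :+ r)) refl r t ⟩
        (t ^ 6 + t) + (r ^ 6 + r)
          ≈⟨ +-congʳ (^5-injective (trans (sym (g[r^5]≈[r^6+r]^5 t)) (trans eq (g[r^5]≈[r^6+r]^5 r)))) ⟩
        (r ^ 6 + r) + (r ^ 6 + r)
          ≈⟨ characteristic-2 _ ⟩
        0# ∎))

    Tr[r+d]≈Tr[r]+1 : Tr ((r + d) ^ 5) ≈ Tr (r ^ 5) + 1#
    Tr[r+d]≈Tr[r]+1 = x+y≈0⇒x≈y (begin
      Tr ((r + d) ^ 5) + (Tr (r ^ 5) + 1#)    ≈⟨ +-congˡ (+-congˡ Tr-1#) ⟨
      Tr ((r + d) ^ 5) + (Tr (r ^ 5) + Tr 1#) ≈⟨ +-congˡ (Tr-+ (r ^ 5) 1#) ⟨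
      Tr ((r + d) ^ 5) + Tr (r ^ 5 + 1#)      ≈⟨ Tr-+ ((r + d) ^ 5) (r ^ 5 + 1#) ⟨
      Tr e                                    ≈⟨ Tr-x*x e ⟨
      Tr (e * e)                              ≈⟨ Tr-cong e*e≈d^5*d^5+d^5 ⟩
      Tr (d ^ 5 * d ^ 5 + d ^ 5)              ≈⟨ Tr[x*x+x]≈0 (d ^ 5) ⟩
      0#                                      ∎)
      where
      open ≈-Reasoning
      e : Carrier
      e = (r + d) ^ 5 + (r ^ 5 + 1#)
      e*e≈d^5*d^5+d^5 : e * e ≈ d ^ 5 * d ^ 5 + d ^ 5
      e*e≈d^5*d^5+d^5 = begin
        e * e
          -- With D = `D₅ (r ^ 2) d`, expansion in characteristic 2 gives e² = D² + d⁵D + d¹⁰ + 1.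
          -- Splitting off the multiple (D + 1 + d⁵)(D + 1) leaves d¹⁰ + d⁵.
          ≈⟨ solve 2 (λ r d → let e = (r :+ d) :^ 5 :+ (r :^ 5 :+ con 1ℙ)
                                  D+1 = (d :^ 5 :+ r :^ 2 :* d :^ 3 :+ (r :^ 2) :^ 2 :* d) :+ con 1ℙ in
               e :* e := (D+1 :+ d :^ 5) :* D+1 :+ (d :^ 5 :* d :^ 5 :+ d :^ 5)) refl r d ⟩
        (D₅ (r ^ 2) d + 1# + d ^ 5) * (D₅ (r ^ 2) d + 1#) + (d ^ 5 * d ^ 5 + d ^ 5)
          ≈⟨ +-congʳ (trans (*-congˡ D+1≈0) (zeroʳ _)) ⟩
        0# + (d ^ 5 * d ^ 5 + d ^ 5)
          ≈⟨ +-identityˡ _ ⟩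
        d ^ 5 * d ^ 5 + d ^ 5 ∎

  abstract
    -- Packages the other point of the fibre with its properties. Being abstract, it hides the
    -- witness (r + d)⁵, so that later proofs rely on these properties alone.
    g-partner : ∀ x → ∃ λ x′ → g x′ ≈ g x × Tr x′ ≈ Tr x + 1# × (∀ z → g z ≈ g x → z ≈ x ⊎ z ≈ x′)
    g-partner x =
      let r , r⁵≈x = ⁵√ x
          d , D≈1  = injective⇒surjective {D₅ (r ^ 2)} D₅-cong D₅-injective 1#
      in (r + d) ^ 5 ,
         trans (g[r+d]≈g[r] D≈1) (g-cong r⁵≈x) ,
         trans (Tr[r+d]≈Tr[r]+1 D≈1) (+-congʳ (Tr-cong r⁵≈x)) ,
         λ z gz≈gx →
           let t , t⁵≈z = ⁵√ z in
           Sum.map (λ t≈r → trans (sym t⁵≈z) (trans (^-congˡ 5 t≈r) r⁵≈x))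
                   (λ t≈r+d → trans (sym t⁵≈z) (^-congˡ 5 t≈r+d))
                   (g-fiber D≈1 t (trans (g-cong t⁵≈z) (trans gz≈gx (g-cong (sym r⁵≈x)))))

  x≉x+1 : ∀ {x} → x ≉ x + 1#
  x≉x+1 {x} eq = 0≉1 (begin
    0#             ≈⟨ characteristic-2 x ⟨
    x + x          ≈⟨ +-congˡ eq ⟩
    x + (x + 1#)   ≈⟨ solve 1 (λ x → x :+ (x :+ con 1ℙ) := con 1ℙ) refl x ⟩
    1#             ∎)
    where open ≈-Reasoning

  -- The two points of a fibre differ in trace, so `g` and `Tr` together separate points. Congruence
  -- and injectivity of `σ` and `π`, whose values are chosen through searches, reduce to computing
  -- these two invariants.
  g-Tr-injective : ∀ {x y} → g x ≈ g y → Tr x ≈ Tr y → x ≈ y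
  g-Tr-injective {x} {y} gx≈gy Trx≈Try with g-partner y
  ... | y′ , _ , Try′ , fiber with fiber x gx≈gy
  ...   | inj₁ x≈y  = x≈y
  ...   | inj₂ x≈y′ = contradiction
    (trans (sym Trx≈Try) (trans (Tr-cong x≈y′) Try′)) x≉x+1

  σ : Carrier → Carrier
  σ = proj₁ ∘ g-partner

  g-σ : ∀ x → g (σ x) ≈ g x
  g-σ = proj₁ ∘ proj₂ ∘ g-partner

  Tr-σ : ∀ x → Tr (σ x) ≈ Tr x + 1#
  Tr-σ = proj₁ ∘ proj₂ ∘ proj₂ ∘ g-partner

  σ-cong : σ Preserves _≈_ ⟶ _≈_
  σ-cong {x} {y} x≈y = g-Tr-injective
    (trans (g-σ x) (trans (g-cong x≈y) (sym (g-σ y))))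
    (trans (Tr-σ x) (trans (+-congʳ (Tr-cong x≈y)) (sym (Tr-σ y))))

  σ-injective : Injective _≈_ _≈_ σ
  σ-injective {x} {y} σx≈σy = g-Tr-injective
    (trans (sym (g-σ x)) (trans (g-cong σx≈σy) (g-σ y)))
    (∙-cancelʳ 1# (Tr x) (Tr y) (trans (sym (Tr-σ x)) (trans (Tr-cong σx≈σy) (Tr-σ y))))

  -- Either x or its partner has the desired trace. The target is given as the trace of an element
  -- y, which covers both y = b in `π` and a prescribed bit y = `⟦ i ⟧`.
  fiber-with-trace : ∀ x y → ∃ λ x′ → g x′ ≈ g x × Tr x′ ≈ Tr y
  fiber-with-trace x y with Tr x ≟ Tr y
  ... | yes eq = x , refl , eq
  ... | no neq = σ x , g-σ x , trans (Tr-σ x)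
    (sym (Tr-apart (neq ∘ sym)))

  twoToOne : TwoToOne g
  twoToOne y (x , gx≈y) = x , σ x ,
    (λ x≈σx → x≉x+1 (trans (Tr-cong x≈σx) (Tr-σ x))) ,
    gx≈y , trans (g-σ x) gx≈y ,
    λ z gz≈y → proj₂ (proj₂ (proj₂ (g-partner x))) z (trans gz≈y (sym gx≈y))

  fiber-meets-H : ∀ y → ∃ (Fiber g y) → ∀ i → ∃! _≈_ (λ x → Fiber g y x × H⟨ i ⟩ x)
  fiber-meets-H y (x , gx≈y) i = let x′ , gx′≈gx , Trx′≈ = fiber-with-trace x ⟦ i ⟧ in
    x′ ,
    (trans gx′≈gx gx≈y , trans Trx′≈ (Tr-⟦⟧ i)) ,
    λ (gz≈y , Trz≈i) → g-Tr-injective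
      (trans gx′≈gx (trans gx≈y (sym gz≈y)))
      (trans Trx′≈ (trans (Tr-⟦⟧ i) (sym Trz≈i)))

  -- b ↦ b² + b maps both H₀ and H₁ bijectively onto H₀; correcting it by σ on H₁ gives
  -- a permutation π with δ = g ∘ π.
  π : Carrier → Carrier
  π b = proj₁ (fiber-with-trace (b * b + b) b)

  g-π : ∀ b → g (π b) ≈ δ b
  g-π b = trans (proj₁ (proj₂ (fiber-with-trace (b * b + b) b))) (sym (δ≈g[b*b+b] b))

  Tr-π : ∀ b → Tr (π b) ≈ Tr b
  Tr-π b = proj₂ (proj₂ (fiber-with-trace (b * b + b) b))

  δ-cong : δ Preserves _≈_ ⟶ _≈_
  δ-cong x≈y = +-congʳ (+-cong (F-cong x≈y) (F-cong (+-congʳ x≈y)))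

  π-cong : π Preserves _≈_ ⟶ _≈_
  π-cong {x} {y} x≈y = g-Tr-injective
    (trans (g-π x) (trans (δ-cong x≈y) (sym (g-π y))))
    (trans (Tr-π x) (trans (Tr-cong x≈y) (sym (Tr-π y))))

  -- Both b² + b and b′² + b′ have trace 0, so equal values of `g` make them equal, whence b′ is b
  -- or b + 1. The second option would change the trace, since Tr 1 = 1.
  δ-Tr-injective : ∀ {b b′} → δ b ≈ δ b′ → Tr b ≈ Tr b′ → b ≈ b′
  δ-Tr-injective {b} {b′} δb≈δb′ Trb≈Trb′ = x+y≈0⇒x≈y (x*y≈0⇒y≈0 b+b′+1≉0 (begin
    (b + b′ + 1#) * (b + b′)        ≈⟨ solve 2 (λ x y → (x :+ y :+ con 1ℙ) :* (x :+ y) := (x :* x :+ x) :+ (y :* y :+ y)) refl b b′ ⟩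
    (b * b + b) + (b′ * b′ + b′)    ≈⟨ +-congʳ (g-Tr-injective gb≈gb′ (trans (Tr[x*x+x]≈0 b) (sym (Tr[x*x+x]≈0 b′)))) ⟩
    (b′ * b′ + b′) + (b′ * b′ + b′) ≈⟨ characteristic-2 _ ⟩
    0#                              ∎))
    where
    open ≈-Reasoning
    gb≈gb′ : g (b * b + b) ≈ g (b′ * b′ + b′)
    gb≈gb′ = begin
      g (b * b + b)     ≈⟨ δ≈g[b*b+b] b ⟨
      δ b               ≈⟨ δb≈δb′ ⟩
      δ b′              ≈⟨ δ≈g[b*b+b] b′ ⟩
      g (b′ * b′ + b′)  ∎
    b+b′+1≉0 : b + b′ + 1# ≉ 0#
    b+b′+1≉0 eq = x≉x+1 (begin
      Tr b′             ≈⟨ Trb≈Trb′ ⟨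
      Tr b              ≈⟨ Tr-cong (x+y≈0⇒x≈y (trans (sym (+-assoc b b′ 1#)) eq)) ⟩
      Tr (b′ + 1#)      ≈⟨ Tr-+ b′ 1# ⟩
      Tr b′ + Tr 1#     ≈⟨ +-congˡ Tr-1# ⟩
      Tr b′ + 1#        ∎)

  π-injective : Injective _≈_ _≈_ π
  π-injective {x} {y} πx≈πy = δ-Tr-injective
    (trans (sym (g-π x)) (trans (g-cong πx≈πy) (g-π y)))
    (trans (sym (Tr-π x)) (trans (Tr-cong πx≈πy) (Tr-π y)))

  g∈Δ : ∀ x → Δ (g x)
  g∈Δ x = let b , πb≈x = injective⇒surjective π-cong π-injective x in
    b , trans (g-cong (sym πb≈x)) (g-π b)

  MCM-image : ∀ i → Image MCM H⟨ i ⟩ ≐ Δ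
  MCM-image i =
    (λ {t} (x , _ , t≈MCMx) → let b , gx≈δb = g∈Δ x in
      b , trans t≈MCMx (trans (sym (g≈MCM x)) gx≈δb)) ,
    (λ {t} (b , t≈δb) → let x , gx≈ , Trx≈ = fiber-with-trace (b * b + b) ⟦ i ⟧ in
      x , trans Trx≈ (Tr-⟦⟧ i) ,
      trans t≈δb (trans (δ≈g[b*b+b] b) (trans (sym gx≈) (g≈MCM x))))

-- Character sums: G₁ = 0, the formula for 2S, and the values of T on the radical.

module CharacterSumProperties {n : ℕ} (odd : parity n ≡ 1ℙ) (𝔽 : FiniteField (2 ^ℕ n) c ℓ) where

  open BinaryField {n} 𝔽 hiding (zero)
  open FiniteFieldProperties 𝔽
  open BinaryFieldProperties {n = n} 𝔽
  open OddDegree {n = n} odd 𝔽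

  private
    open SemiringExp semiring using (^-congˡ)
    open GroupProperties +-group using (∙-cancelˡ)
    module ≈-Reasoning = SetoidReasoning setoid
    module ∑ℤ = SemiringSum ℤₚ.+-*-semiring

  -- The argument of `χ` in G₁. The factor `1#` is kept so that `G 1ℙ u` unfolds to the sum of
  -- `χ (q u s)`.
  q : Carrier → Carrier → Carrier
  q u s = u * g s + 1# * s

  q-cong : ∀ u → q u Preserves _≈_ ⟶ _≈_
  q-cong u x≈y = +-cong (*-congˡ (g-cong x≈y)) (*-congˡ x≈y)

  q≈T : ∀ u w → Tr (q u w) ≈ T u w
  q≈T u w = Tr-cong (trans (+-congˡ (*-identityˡ w)) (+-comm (u * g w) w))

  G₁≡0 : ∀ u → G 1ℙ u ≡ 0ℤ
  G₁≡0 u = ∑-sign-reversing (χ-cong ∘ q-cong u) σ-cong σ-injective χqσ≡-χq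
    where
    qσ≈q+ : ∀ s → q u (σ s) ≈ (s + σ s) + q u s
    qσ≈q+ s = trans (+-congʳ (*-congˡ (g-σ s)))
      (solve 3 (λ a s t → a :+ con 1ℙ :* t := (s :+ t) :+ (a :+ con 1ℙ :* s)) refl (u * g s) s (σ s))
    Tr[s+σs]≈1 : ∀ s → Tr (s + σ s) ≈ 1#
    Tr[s+σs]≈1 s = begin
      Tr (s + σ s)        ≈⟨ Tr-+ s (σ s) ⟩
      Tr s + Tr (σ s)     ≈⟨ +-congˡ (Tr-σ s) ⟩
      Tr s + (Tr s + 1#)  ≈⟨ +-assoc (Tr s) (Tr s) 1# ⟨
      Tr s + Tr s + 1#    ≈⟨ +-congʳ (characteristic-2 (Tr s)) ⟩
      0# + 1#             ≈⟨ +-identityˡ 1# ⟩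
      1#                  ∎
      where open ≈-Reasoning
    χqσ≡-χq : ∀ s → χ (q u (σ s)) ≡ -1ℤ *ℤ χ (q u s)
    χqσ≡-χq s = ≡.trans (χ-cong (qσ≈q+ s)) (≡.trans (χ-+ (s + σ s) (q u s))
      (≡.cong (_*ℤ χ (q u s)) (χ≡-1 (Tr[s+σs]≈1 s))))

  χg-cong : ∀ u → (λ s → χ (u * g s)) Preserves _≈_ ⟶ _≡_
  χg-cong u x≈y = χ-cong (*-congˡ (g-cong x≈y))

  G₀≡∑ : ∀ u → G 0ℙ u ≡ ∑ (λ s → χ (u * g s))
  G₀≡∑ u = ∑-cong (λ s → χ-cong (trans (+-congˡ (zeroˡ s)) (+-identityʳ (u * g s))))

  H≡G₀ : ∀ u → H u ≡ G 0ℙ u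
  H≡G₀ u = ≡.trans (∑-cong (λ b → χ-cong (*-congˡ (sym (g-π b)))))
    (≡.trans (∑-reindex (χg-cong u) π-cong π-injective) (≡.sym (G₀≡∑ u)))

  ∑-comm : ∀ (f : Carrier → Carrier → ℤ) → ∑ (λ x → ∑ (f x)) ≡ ∑ (λ y → ∑ (λ x → f x y))
  ∑-comm f = ∑ℤ.∑-comm {2 ^ℕ n} {2 ^ℕ n} (λ i j → f (element i) (element j))

  abstract
    -- A point mass z at a. It is abstract so that only the two evaluation rules below, not the
    -- equality test, are seen by later proofs.
    _at_ : ℤ → Carrier → Carrier → ℤ
    (z at a) x = if does (x ≟ a) then z else 0ℤ

    at-≈ : ∀ {z a x} → x ≈ a → (z at a) x ≡ z
    at-≈ {z} {a} {x} x≈a = ≡.cong (if_then z else 0ℤ) (dec-true (x ≟ a) x≈a)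

    at-≉ : ∀ {z a x} → x ≉ a → (z at a) x ≡ 0ℤ
    at-≉ {z} {a} {x} x≉a = ≡.cong (if_then z else 0ℤ) (dec-false (x ≟ a) x≉a)

  at-cong : ∀ {z a} → (z at a) Preserves _≈_ ⟶ _≡_
  at-cong {z} {a} {x} {y} x≈y with y ≟ a
  ... | yes y≈a = ≡.trans (at-≈ (trans x≈y y≈a)) (≡.sym (at-≈ y≈a))
  ... | no  y≉a = ≡.trans (at-≉ (y≉a ∘ trans (sym x≈y))) (≡.sym (at-≉ y≉a))

  ∑-at : ∀ z a → ∑ (z at a) ≡ z
  ∑-at z a = ≡.trans
    (sum-supported-at ℤₚ.+-0-commutativeMonoid at-cong a (λ _ → at-≉))
    (at-≈ {z} {a} refl)

  -- Each s places the mass χ(u g(s)) at g(s). A point of Δ collects equal masses from the two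
  -- elements of its fibre; any other point collects nothing, since `g` takes values in Δ.
  ∑-g-fiber : ∀ u t → ∑ (λ s → (χ (u * g s) at g s) t) ≡ + 2 *ℤ (if does (Δ? t) then χ (u * t) else 0ℤ)
  ∑-g-fiber u t = by-cases (Δ? t)
    where
    by-cases : (d : Dec (Δ t)) → ∑ (λ s → (χ (u * g s) at g s) t) ≡ + 2 *ℤ (if does d then χ (u * t) else 0ℤ)
    by-cases (no t∉Δ) = ≡.trans
      (∑-cong (λ s → at-≉ {χ (u * g s)} (λ t≈gs → t∉Δ (let b , gs≈δb = g∈Δ s in b , trans t≈gs gs≈δb))))
      (∑ℤ.sum-replicate-zero (2 ^ℕ n))
    by-cases (yes (b , t≈δb)) = begin
      ∑ (λ s → (χ (u * g s) at g s) t)      ≡⟨ ∑-cong split ⟩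
      ∑ (λ s → (z at x₁) s ℤ.+ (z at x₂) s)  ≡⟨ ∑ℤ.∑-distrib-+ ((z at x₁) ∘ element) ((z at x₂) ∘ element) ⟩
      ∑ (z at x₁) ℤ.+ ∑ (z at x₂)            ≡⟨ ≡.cong₂ ℤ._+_ (∑-at z x₁) (∑-at z x₂) ⟩
      z ℤ.+ z                                ≡⟨ ≡.cong (ℤ._+_ z) (ℤₚ.*-identityˡ z) ⟨
      z ℤ.+ 1ℤ *ℤ z                          ≡⟨ ℤₚ.suc-* 1ℤ z ⟨
      + 2 *ℤ z                               ∎
      where
      open ≡.≡-Reasoning
      z : ℤ
      z = χ (u * t)
      fiber : HasExactlyTwoElements (Fiber g t)
      fiber = twoToOne t (π b , trans (g-π b) (sym t≈δb))
      x₁ x₂ : Carrier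
      x₁ = proj₁ fiber
      x₂ = proj₁ (proj₂ fiber)
      x₁≉x₂ : x₁ ≉ x₂
      x₁≉x₂ = proj₁ (proj₂ (proj₂ fiber))
      gx₁≈t : g x₁ ≈ t
      gx₁≈t = proj₁ (proj₂ (proj₂ (proj₂ fiber)))
      gx₂≈t : g x₂ ≈ t
      gx₂≈t = proj₁ (proj₂ (proj₂ (proj₂ (proj₂ fiber))))
      only : ∀ x → g x ≈ t → x ≈ x₁ ⊎ x ≈ x₂
      only = proj₂ (proj₂ (proj₂ (proj₂ (proj₂ fiber))))
      inside : ∀ s → t ≈ g s → s ≈ x₁ ⊎ s ≈ x₂ → z ≡ (z at x₁) s ℤ.+ (z at x₂) s
      inside s t≈gs (inj₁ s≈x₁) = ≡.sym (≡.trans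
        (≡.cong₂ ℤ._+_ (at-≈ s≈x₁) (at-≉ (λ s≈x₂ → x₁≉x₂ (trans (sym s≈x₁) s≈x₂)))) (ℤₚ.+-identityʳ z))
      inside s t≈gs (inj₂ s≈x₂) = ≡.sym (≡.trans
        (≡.cong₂ ℤ._+_ (at-≉ (λ s≈x₁ → x₁≉x₂ (trans (sym s≈x₁) s≈x₂))) (at-≈ s≈x₂)) (ℤₚ.+-identityˡ z))
      split-dec : ∀ s → Dec (t ≈ g s) → (χ (u * g s) at g s) t ≡ (z at x₁) s ℤ.+ (z at x₂) s
      split-dec s (yes t≈gs) = ≡.trans (at-≈ t≈gs)
        (≡.trans (χ-cong (*-congˡ (sym t≈gs))) (inside s t≈gs (only s (sym t≈gs))))
      split-dec s (no t≉gs) = ≡.trans (at-≉ t≉gs) (≡.sym (≡.cong₂ ℤ._+_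
        (at-≉ (λ s≈x₁ → t≉gs (trans (sym gx₁≈t) (g-cong (sym s≈x₁)))))
        (at-≉ (λ s≈x₂ → t≉gs (trans (sym gx₂≈t) (g-cong (sym s≈x₂)))))))
      split : ∀ s → (χ (u * g s) at g s) t ≡ (z at x₁) s ℤ.+ (z at x₂) s
      split s = split-dec s (t ≟ g s)

  -- Double counting: summing the point masses over t first recovers G₀, and summing over s first
  -- gives 2 on Δ.
  2S≡G₀ : ∀ u → + 2 *ℤ S u ≡ G 0ℙ u
  2S≡G₀ u = begin
    + 2 *ℤ S u                                    ≡⟨ ∑ℤ.*-distribˡ-sum (+ 2) (λ i → if does (Δ? (element i)) then χ (u * element i) else 0ℤ) ⟩
    ∑ (λ t → + 2 *ℤ (if does (Δ? t) then χ (u * t) else 0ℤ)) ≡⟨ ∑-cong (∑-g-fiber u) ⟨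
    ∑ (λ t → ∑ (λ s → (χ (u * g s) at g s) t))     ≡⟨ ∑-comm (λ s → χ (u * g s) at g s) ⟨
    ∑ (λ s → ∑ (χ (u * g s) at g s))               ≡⟨ ∑-cong (λ s → ∑-at (χ (u * g s)) (g s)) ⟩
    ∑ (λ s → χ (u * g s))                          ≡⟨ G₀≡∑ u ⟨
    G 0ℙ u                                         ∎
    where open ≡.≡-Reasoning

  -- The polar form of Tr ∘ q and its radical.

  polar : Carrier → Carrier → Carrier → Carrier
  polar u w s = u * (s ^ 4 * w + s * w ^ 4) + u * (s ^ 4 * w ^ 2 + s ^ 2 * w ^ 4)

  polar-cong : ∀ u w → polar u w Preserves _≈_ ⟶ _≈_
  polar-cong u w x≈y = +-cong
    (*-congˡ (+-cong (*-congʳ (^-congˡ 4 x≈y)) (*-congʳ x≈y)))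
    (*-congˡ (+-cong (*-congʳ (^-congˡ 4 x≈y)) (*-congʳ (^-congˡ 2 x≈y))))

  polar-+ : ∀ u w s t → polar u w (s + t) ≈ polar u w s + polar u w t
  polar-+ = solve 4 (λ u w s t →
    let polar = λ s → u :* (s :^ 4 :* w :+ s :* w :^ 4) :+ u :* (s :^ 4 :* w :^ 2 :+ s :^ 2 :* w :^ 4) in
    polar (s :+ t) := polar s :+ polar t) refl

  -- As g(s) = s⁶ + s⁵ + s² + s, the terms with s² and s are additive and leave no mixed part. The
  -- mixed parts of s⁵ and s⁶ are the two summands of `polar`.
  q-+ : ∀ u s w → q u s + q u (s + w) ≈ q u w + polar u w s
  q-+ = solve 3 (λ u s w →
    let q = λ s → u :* (s :* (s :+ con 1ℙ) :^ 5) :+ con 1ℙ :* s in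
    q s :+ q (s :+ w) := q w :+
      (u :* (s :^ 4 :* w :+ s :* w :^ 4) :+ u :* (s :^ 4 :* w :^ 2 :+ s :^ 2 :* w :^ 4))) refl

  -- The mixed part of u s⁶ is the square of that of √u s³, and the trace does not see squaring.
  -- Hence Tr ∘ `q u` and `Q u` have the same polar form, and `V u` is the radical of both.
  Tr-polar : ∀ u w s → Tr (polar u w s) ≈ Q u (s + w) + Q u s + Q u w
  Tr-polar u w s = begin
    Tr (a + u * e)        ≈⟨ Tr-+ a (u * e) ⟩
    Tr a + Tr (u * e)     ≈⟨ +-congˡ (Tr-cong (*-congʳ (proj₁ (proj₂ (unique-square-root u))))) ⟨
    Tr a + Tr (v * v * e) ≈⟨ +-congˡ (Tr-cong (solve 3 (λ v w s →
                               v :* v :* (s :^ 4 :* w :^ 2 :+ s :^ 2 :* w :^ 4) :=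
                               (v :* (s :^ 2 :* w :+ s :* w :^ 2)) :* (v :* (s :^ 2 :* w :+ s :* w :^ 2))) refl v w s)) ⟩
    Tr a + Tr (b * b)     ≈⟨ +-congˡ (Tr-x*x b) ⟩
    Tr a + Tr b           ≈⟨ Tr-+ a b ⟨
    Tr (a + b)            ≈⟨ Tr-cong (solve 4 (λ u v w s →
                               let k = λ s → u :* s :^ 5 :+ v :* s :^ 3 in
                               u :* (s :^ 4 :* w :+ s :* w :^ 4) :+ v :* (s :^ 2 :* w :+ s :* w :^ 2) :=
                               k (s :+ w) :+ k s :+ k w) refl u v w s) ⟩
    Tr (k (s + w) + k s + k w)          ≈⟨ Tr-+ (k (s + w) + k s) (k w) ⟩
    Tr (k (s + w) + k s) + Q u w        ≈⟨ +-congʳ (Tr-+ (k (s + w)) (k s)) ⟩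
    Q u (s + w) + Q u s + Q u w         ∎
    where
    open ≈-Reasoning
    v a b e : Carrier
    v = √ u
    a = u * (s ^ 4 * w + s * w ^ 4)
    b = v * (s ^ 2 * w + s * w ^ 2)
    e = s ^ 4 * w ^ 2 + s ^ 2 * w ^ 4
    k : Carrier → Carrier
    k s = u * s ^ 5 + v * s ^ 3

  term≤∑ : ∀ {f} → (∀ x → 0ℤ ℤ.≤ f x) → ∀ i → f (element i) ℤ.≤ ∑ f
  term≤∑ {f} 0≤f = term≤sum (f ∘ element) (0≤f ∘ element)
    where
    0≤sum : ∀ {k} (t : Fin k → ℤ) → (∀ j → 0ℤ ℤ.≤ t j) → 0ℤ ℤ.≤ ∑ℤ.sum t
    0≤sum {zero}  t 0≤t = ℤₚ.≤-refl
    0≤sum {suc k} t 0≤t = ℤₚ.+-mono-≤ (0≤t zero) (0≤sum (t ∘ suc) (0≤t ∘ suc))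
    term≤sum : ∀ {k} (t : Fin k → ℤ) → (∀ j → 0ℤ ℤ.≤ t j) → ∀ i → t i ℤ.≤ ∑ℤ.sum t
    term≤sum t 0≤t zero    = ≡.subst (ℤ._≤ ∑ℤ.sum t) (ℤₚ.+-identityʳ (t zero))
      (ℤₚ.+-monoʳ-≤ (t zero) (0≤sum (t ∘ suc) (0≤t ∘ suc)))
    term≤sum t 0≤t (suc i) = ≡.subst (ℤ._≤ ∑ℤ.sum t) (ℤₚ.+-identityˡ (t (suc i)))
      (ℤₚ.+-mono-≤ (0≤t zero) (term≤sum (t ∘ suc) (0≤t ∘ suc) i))

  -- If T(u,·) vanished on V u, then
  -- G₁(u)² = ∑_w χ(q u w) ∑_s χ(polar u w s) = 2ⁿ |V u| would be positive.
  T-nonvanishing : ∀ u → ¬ (∀ w → V u w → T u w ≈ 0#)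
  T-nonvanishing u T≈0 = 1≰0 (≡.subst (1ℤ ℤ.≤_) ∑inner≡0 1≤∑inner)
    where
    inner : Carrier → ℤ
    inner w = ∑ (λ s → χ (q u w + polar u w s))

    1≰0 : ¬ (1ℤ ℤ.≤ 0ℤ)
    1≰0 (ℤ.+≤+ ())

    ∑inner≡0 : ∑ inner ≡ 0ℤ
    ∑inner≡0 = begin
      -- By `q-+` the double sum is G₁(u)² in the form ∑ χ(q(s)) χ(q(s + w)); for fixed s,
      -- translating w turns the sum over w into G₁(u) = 0.
      ∑ inner                                           ≡⟨ ∑-comm (λ s w → χ (q u w + polar u w s)) ⟨
      ∑ (λ s → ∑ (λ w → χ (q u w + polar u w s)))       ≡⟨ ∑-cong (λ s → ∑-cong (λ w →
                                                              ≡.trans (χ-cong (sym (q-+ u s w))) (χ-+ (q u s) (q u (s + w))))) ⟩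
      ∑ (λ s → ∑ (λ w → χ (q u s) *ℤ χ (q u (s + w))))  ≡⟨ ∑-cong (λ s → ∑ℤ.*-distribˡ-sum (χ (q u s)) (λ i → χ (q u (s + element i)))) ⟨
      ∑ (λ s → χ (q u s) *ℤ ∑ (λ w → χ (q u (s + w))))  ≡⟨ ∑-cong (λ s → ≡.cong (χ (q u s) *ℤ_)
                                                              (≡.trans (∑-reindex (χ-cong ∘ q-cong u) +-congˡ (∙-cancelˡ s _ _)) (G₁≡0 u))) ⟩
      ∑ (λ s → χ (q u s) *ℤ 0ℤ)                         ≡⟨ ∑-cong (λ s → ℤₚ.*-zeroʳ (χ (q u s))) ⟩
      ∑ (λ _ → 0ℤ)                                      ≡⟨ ∑ℤ.sum-replicate-zero (2 ^ℕ n) ⟩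
      0ℤ                                                ∎
      where open ≡.≡-Reasoning

    -- For w in the radical every term is 1. Positivity is all that the contradiction needs, so one
    -- term is kept as a lower bound instead of the count 2ⁿ.
    1≤inner : ∀ w → (∀ s → Tr (polar u w s) ≈ 0#) → 1ℤ ℤ.≤ inner w
    1≤inner w polar≈0 = ≡.subst (ℤ._≤ inner w) (terms≡1 (element (index 0#)))
      (term≤∑ (λ s → ≡.subst (0ℤ ℤ.≤_) (≡.sym (terms≡1 s)) (ℤ.+≤+ z≤n)) (index 0#))
      where
      terms≡1 : ∀ s → χ (q u w + polar u w s) ≡ 1ℤ
      terms≡1 s = χ≡1 (trans (Tr-+ (q u w) (polar u w s)) (trans
        (+-cong (trans (q≈T u w) (T≈0 w (λ s → trans (sym (Tr-polar u w s)) (polar≈0 s)))) (polar≈0 s))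
        (+-identityˡ 0#)))

    -- Outside the radical, translation by an s₀ with polar trace 1 reverses every sign.
    inner≡0 : ∀ w s₀ → Tr (polar u w s₀) ≈ 1# → inner w ≡ 0ℤ
    inner≡0 w s₀ polar≈1 = ∑-sign-reversing (χ-cong ∘ +-congˡ ∘ polar-cong u w) +-congˡ (∙-cancelˡ s₀ _ _) (λ s →
      ≡.trans (χ-cong (trans (+-congˡ (polar-+ u w s₀ s)) (rearrange (q u w) (polar u w s₀) (polar u w s))))
        (≡.trans (χ-+ (polar u w s₀) _) (≡.cong (_*ℤ χ (q u w + polar u w s)) (χ≡-1 polar≈1))))
      where
      rearrange : ∀ x y z → x + (y + z) ≈ y + (x + z)
      rearrange = solve 3 (λ x y z → x :+ (y :+ z) := y :+ (x :+ z)) refl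

    0≤inner : ∀ w → 0ℤ ℤ.≤ inner w
    0≤inner w = by-cases (any-element?
      (λ s≈s′ → trans (Tr-cong (polar-cong u w (sym s≈s′)))) (λ s → Tr (polar u w s) ≟ 1#))
      where
      by-cases : Dec (∃ λ s → Tr (polar u w s) ≈ 1#) → 0ℤ ℤ.≤ inner w
      by-cases (yes (s₀ , polar≈1)) = ℤₚ.≤-reflexive (≡.sym (inner≡0 w s₀ polar≈1))
      by-cases (no  none)           = ℤₚ.≤-trans (ℤ.+≤+ z≤n) (1≤inner w (λ s →
        [ id , (λ eq → contradiction (s , eq) none) ]′ (Tr≈0⊎Tr≈1 (polar u w s))))

    -- The zero vector always lies in the radical and supplies a positive summand. It appears as
    -- `element (index 0#)` because `∑` runs over enumerated elements.
    1≤∑inner : 1ℤ ℤ.≤ ∑ inner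
    1≤∑inner = ℤₚ.≤-trans
      (1≤inner (element (index 0#)) (λ s → trans (Tr-cong (polar-0 s)) Tr-0#))
      (term≤∑ 0≤inner (index 0#))
      where
      polar-0 : ∀ s → polar u (element (index 0#)) s ≈ 0#
      polar-0 s = trans
        (+-cong (*-congˡ (+-cong (*-congˡ 0≈) (*-congˡ (^-congˡ 4 0≈))))
                (*-congˡ (+-cong (*-congˡ (^-congˡ 2 0≈)) (*-congˡ (^-congˡ 4 0≈)))))
        (solve 2 (λ u s → u :* (s :^ 4 :* con 0ℙ :+ s :* con 0ℙ :^ 4)
                            :+ u :* (s :^ 4 :* con 0ℙ :^ 2 :+ s :^ 2 :* con 0ℙ :^ 4) := con 0ℙ) refl u s)
        where
        0≈ : element (index 0#) ≈ 0#
        0≈ = Inverse.strictlyInverseˡ enumeration 0#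

  -- Here V consists of 0 and the basis vector w. As T(u, 0) = 0, the value T(u, w) = 0 would make
  -- T(u, ·) vanish on V, against `T-nonvanishing`.
  dim-1⇒T≈1 : ∀ u → HasDimension (V u) 1 →
              Σ (∃! _≈_ (λ w → w ≉ 0# × V u w)) (λ (w , _) → T u w ≈ 1#)
  dim-1⇒T≈1 u (b , basis) = (w , (w≉0 , Vw) , unique) , Tw≈1
    where
    open IsBasis basis
    w : Carrier
    w = b zero
    combination≈ : ∀ i → combination (λ (_ : Fin 1) → i) b ≈ ⟦ i ⟧ * w
    combination≈ i = +-identityʳ _
    Vw : V u w
    Vw = Equivalence.from (span w) ((λ _ → 1ℙ) , sym (trans (combination≈ 1ℙ) (*-identityˡ w)))
    w≉0 : w ≉ 0#
    w≉0 w≈0 = contradiction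
      (independent (λ _ → 1ℙ) (trans (combination≈ 1ℙ) (trans (*-identityˡ w) w≈0)) zero) λ ()
    -- The trailing `0#` is the empty rest of the one-term sum in `combination`.
    multiple : ∀ {y} (a : Parity) → y ≈ ⟦ a ⟧ * w + 0# → y ≈ 0# ⊎ w ≈ y
    multiple 0ℙ y≈ = inj₁ (trans y≈ (trans (+-identityʳ _) (zeroˡ w)))
    multiple 1ℙ y≈ = inj₂ (sym (trans y≈ (trans (+-identityʳ _) (*-identityˡ w))))
    zero-or-w : ∀ {y} → V u y → y ≈ 0# ⊎ w ≈ y
    zero-or-w {y} Vy = let a , y≈ = Equivalence.to (span y) Vy in multiple (a zero) y≈
    unique : ∀ {y} → y ≉ 0# × V u y → w ≈ y
    unique (y≉0 , Vy) = [ (λ y≈0 → contradiction y≈0 y≉0) , id ]′ (zero-or-w Vy)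
    T-cong : ∀ {x y} → x ≈ y → T u x ≈ T u y
    T-cong x≈y = Tr-cong (+-cong x≈y (*-congˡ (g-cong x≈y)))
    T0≈0 : T u 0# ≈ 0#
    T0≈0 = trans (Tr-cong (solve 1 (λ u → con 0ℙ :+ u :* (con 0ℙ :* (con 0ℙ :+ con 1ℙ) :^ 5) := con 0ℙ) refl u)) Tr-0#
    Tw≈1 : T u w ≈ 1#
    Tw≈1 = [ (λ Tw≈0 → contradiction
               (λ y Vy → [ (λ y≈0 → trans (T-cong y≈0) T0≈0) , (λ w≈y → trans (T-cong (sym w≈y)) Tw≈0) ]′ (zero-or-w Vy))
               (T-nonvanishing u))
           , id ]′ (Tr≈0⊎Tr≈1 (w + u * g w))

theorem11p7 : {c ℓ : Level} (n : ℕ) → parity n ≡ 1ℙ → (𝔽 : FiniteField (2 ^ℕ n) c ℓ) →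
    let open BinaryField {n} 𝔽 in
    (∀ u → u ≉ 0# → HasDimension (V u) 1 →
    Σ (∃! _≈_ (λ w → w ≉ 0# × V u w)) (λ (w , _) → T u w ≈ 1#))
    ×
    (∀ u → u ≉ 0# → HasDimension (V u) 3 → ¬ (∀ w → V u w → T u w ≈ 0#))
    ×
    (∀ u → G 1ℙ u ≡ 0ℤ)
    ×
    ((∀ x → g x ≈ MCM x)
    × TwoToOne g
    × (∀ y → ∃ (Fiber g y) → ∀ i → ∃! _≈_ (λ x → Fiber g y x × H⟨ i ⟩ x))
    × Image MCM H⟨ 0ℙ ⟩ ≐ Δ
    × Image MCM H⟨ 1ℙ ⟩ ≐ Δ)
    ×
    (∀ u → u ≉ 0# →
    + 2 *ℤ S u ≡ H u
    × H u ≡ G 0ℙ u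
    × G 0ℙ u ≡ ∑ (λ s → χ (u * g s)))
theorem11p7 n odd 𝔽 =
  (λ u _ → dim-1⇒T≈1 u) ,
  (λ u _ _ → T-nonvanishing u) ,
  G₁≡0 ,
  (g≈MCM , twoToOne , fiber-meets-H , MCM-image 0ℙ , MCM-image 1ℙ) ,
  λ u _ → ≡.trans (2S≡G₀ u) (≡.sym (H≡G₀ u)) , H≡G₀ u , G₀≡∑ u
  where
  open BinaryFieldProperties {n = n} 𝔽
  open OddDegree {n = n} odd 𝔽
  open CharacterSumProperties {n = n} odd 𝔽
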